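{- For every integer $n\geqslant 3$, the number of partitions of $n$ with no parts equal to $1$ and with the largest part occurring more than once equals $\nabla^2[p](n)=p(n)-2p(n-1)+p(n-2)$, and $$\nabla^2 [p](n) = -\sum_{k=4}^{n+5} S^{(4)}_{n+5,k}\, \mu(k).$$
   Context: $p(m)$ denotes the number of partitions of the non-negative integer $m$ (with $p(0)=1$). The $N$th order backward difference of a function $f$ is $\nabla^N[f](x)=\sum_{k=0}^N(-1)^k\binom{N}{k}f(x-k)$. $\mu$ is the classical Möbius function on positive integers: $\mu(m)=0$ if $m$ is divisible by the square of a prime, and $\mu(m)=(-1)^s$ if $m$ is a product of $s\geqslant 0$ distinct primes. For integers $r\geqslant 1$, $k\geqslant 1$, $m\geqslant 0$, $S^{(r)}_{m,k}$ denotes the number of $k$'s in the partitions of $m$ with smallest part at least $r$, i.e. the total number of occurrences (with multiplicity) of the part $k$ summed over all partitions of $m$ all of whose parts are $\geqslant r$. -}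

module Defs where

open import Data.Bool.Base using (if_then_else_)
open import Data.Integer.Base as ℤ using (ℤ; 0ℤ; -1ℤ)
open import Data.List.Base
  using (List; []; _∷_; length; map; filter; foldr; concatMap; upTo)
open import Data.List.Extrema.Nat using (max)
open import Data.List.Membership.Propositional using (_∈_; _∉_)
open import Data.List.Membership.Propositional.Properties
  using (∈-map⁺; ∈-map⁻; ∈-concatMap⁺; ∈-concatMap⁻; ∈-upTo⁺; ∈-∃++)
open import Data.List.Properties using (∷-injectiveˡ; ∷-injectiveʳ)
open import Data.List.Relation.Binary.Disjoint.Propositional using (Disjoint)
open import Data.List.Relation.Binary.Permutation.Propositional
  using (↭⇒↭ₛ)
open import Data.List.Relation.Binary.Permutation.Propositional.Properties
  using (All-resp-↭; ↭-length; shift)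
open import Data.List.Relation.Unary.All as All using (All; []; _∷_; all?)
import Data.List.Relation.Unary.All.Properties as All
open import Data.List.Relation.Unary.AllPairs as AllPairs using (AllPairs; []; _∷_)
import Data.List.Relation.Unary.AllPairs.Properties as AllPairs
open import Data.List.Relation.Unary.Any as Any using (here; there)
open import Data.List.Relation.Unary.Linked using (Linked; []; [-]; _∷_)
open import Data.List.Relation.Unary.Unique.Propositional using (Unique)
import Data.List.Relation.Unary.Unique.Propositional.Properties as Unique
open import Data.Nat.Base
open import Data.Nat.Combinatorics using (_C_)
open import Data.Nat.Divisibility
  using (_∣_; _∣?_; ∣⇒≤; ∣-trans; m∣m*n; *-cancelˡ-∣)
open import Data.Nat.ListAction using (sum; product)
open import Data.Nat.ListAction.Properties using (product-↭)
open import Data.Nat.Primality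
  using (Prime; prime?; prime⇒nonZero; productOfPrimes≢0)
open import Data.Nat.Primality.Factorisation
  using (factorise; factors; factorisationHasAllPrimeFactors; factorisationUnique)
open import Data.Nat.Properties
open import Data.List.Membership.DecPropositional _≟_ using (_∉?_)
open import Data.Product.Base using (∃-syntax; _×_; _,_; proj₁; proj₂)
open import Function.Base using (_∘_)
open import Relation.Binary.PropositionalEquality
open import Relation.Nullary.Decidable using (Dec; does; map′; _×-dec_; dec-true; dec-false)
open import Relation.Nullary.Negation using (¬_; contradiction)
open import Relation.Unary using (Pred; Decidable)

Σ[_⋯_] : ℕ → ℕ → (ℕ → ℤ) → ℤ
Σ[ a ⋯ b ] f = foldr ℤ._+_ 0ℤ (map (λ i → f (a + i)) (upTo (suc b ∸ a)))

-- Meaningful only for N ≤ x, since x ∸ k is truncated.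
∇^ : ℕ → (ℕ → ℤ) → ℕ → ℤ
∇^ N f x = Σ[ 0 ⋯ N ] λ k → (-1ℤ ℤ.^ k) ℤ.* (ℤ.+ (N C k)) ℤ.* f (x ∸ k)

-- A partition is represented by the weakly decreasing list of its parts.
record IsPartition (m : ℕ) (π : List ℕ) : Set where
  constructor isPartition
  field
    positive   : All (1 ≤_) π
    decreasing : Linked _≥_ π
    total      : sum π ≡ m

-- The partitions of m with at most l parts, all of them at most b, listed
-- by their largest part suc i.
boundedPartitions : (l b m : ℕ) → List (List ℕ)
boundedPartitions _       _ zero    = [] ∷ []
boundedPartitions zero    _ (suc m) = []
boundedPartitions (suc l) b (suc m) =
  concatMap (λ i → map (suc i ∷_) (boundedPartitions l (suc i) (m ∸ i)))
            (upTo (b ⊓ suc m))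

-- Lists every partition of m exactly once: see partitions-sound,
-- partitions-complete and partitions-unique.
partitions : ℕ → List (List ℕ)
partitions m = boundedPartitions m m m

private
  sound : ∀ l b m {π} → π ∈ boundedPartitions l b m → IsPartition m π × All (_≤ b) π
  sound zero    b zero (here refl) = isPartition [] [] refl , []
  sound (suc l) b zero (here refl) = isPartition [] [] refl , []
  sound (suc l) b (suc m) {π} π∈ = go (All.all-upTo (b ⊓ suc m)) (∈-concatMap⁻ f π∈)
    where
    f : ℕ → List (List ℕ)
    f i = map (suc i ∷_) (boundedPartitions l (suc i) (m ∸ i))

    link : ∀ {x ρ} → All (_≤ x) ρ → Linked _≥_ ρ → Linked _≥_ (x ∷ ρ)
    link []      []        = [-]
    link (p ∷ _) ρ-dec     = p ∷ ρ-dec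

    go : ∀ {is} → All (_< b ⊓ suc m) is → Any.Any ((π ∈_) ∘ f) is →
         IsPartition (suc m) π × All (_≤ b) π
    go (_ ∷ bs) (there q) = go bs q
    go {i ∷ _} (i<b⊓m ∷ _) (here q) with ∈-map⁻ (suc i ∷_) q
    ... | ρ , ρ∈ , refl with sound l (suc i) (m ∸ i) ρ∈
    ...   | isPartition pos dec tot , ρ≤ =
      isPartition (s≤s z≤n ∷ pos) (link ρ≤ dec)
        (cong suc (trans (cong (i +_) tot)
          (m+[n∸m]≡n (s≤s⁻¹ (≤-trans i<b⊓m (m⊓n≤n b (suc m))))))) ,
      i<b ∷ All.map (λ x≤ → ≤-trans x≤ i<b) ρ≤
      where i<b = ≤-trans i<b⊓m (m⊓n≤m b (suc m))

  complete : ∀ l b m {π} → IsPartition m π → All (_≤ b) π → length π ≤ l →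
             π ∈ boundedPartitions l b m
  complete zero    b zero {[]} _ _ _ = here refl
  complete (suc l) b zero {[]} _ _ _ = here refl
  complete l b (suc m) {[]} (isPartition _ _ ()) _ _
  complete l b zero {suc x ∷ π} (isPartition _ _ ()) _ _
  complete l b m {zero ∷ π} (isPartition (() ∷ _) _ _) _ _
  complete (suc l) b (suc m) {suc i ∷ ρ} (isPartition (_ ∷ pos) dec tot) (i<b ∷ _) (s≤s |ρ|≤l) =
    ∈-concatMap⁺ (λ i → map (suc i ∷_) (boundedPartitions l (suc i) (m ∸ i)))
      (Any.map (λ { refl → ∈-map⁺ (suc i ∷_)
                 (complete l (suc i) (m ∸ i) (isPartition pos (tail dec) rest) (bounded dec) |ρ|≤l) })
               (∈-upTo⁺ (⊓-glb i<b (s≤s i≤m))))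
    where
    tot′ : i + sum ρ ≡ m
    tot′ = suc-injective tot

    i≤m : i ≤ m
    i≤m = subst (i ≤_) tot′ (m≤m+n i (sum ρ))

    rest : sum ρ ≡ m ∸ i
    rest = trans (sym (m+n∸m≡n i (sum ρ))) (cong (_∸ i) tot′)

    tail : ∀ {x xs} → Linked _≥_ (x ∷ xs) → Linked _≥_ xs
    tail [-]     = []
    tail (_ ∷ d) = d

    bounded : ∀ {x xs} → Linked _≥_ (x ∷ xs) → All (_≤ x) xs
    bounded [-]     = []
    bounded (p ∷ d) = p ∷ All.map (λ q → ≤-trans q p) (bounded d)

  unique : ∀ l b m → Unique (boundedPartitions l b m)
  unique zero    b zero    = [] ∷ []
  unique (suc l) b zero    = [] ∷ []
  unique zero    b (suc m) = []
  unique (suc l) b (suc m) =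
    Unique.concat⁺
      (All.map⁺ (All.universal (λ i → Unique.map⁺ {f = suc i ∷_} ∷-injectiveʳ (unique l (suc i) (m ∸ i)))
                              (upTo (b ⊓ suc m))))
      (AllPairs.map⁺ (AllPairs.map disjoint (Unique.upTo⁺ (b ⊓ suc m))))
    where
    disjoint : ∀ {i j} → i ≢ j →
               Disjoint (map (suc i ∷_) (boundedPartitions l (suc i) (m ∸ i)))
                        (map (suc j ∷_) (boundedPartitions l (suc j) (m ∸ j)))
    disjoint {i} {j} i≢j (p , q) with ∈-map⁻ (suc i ∷_) p | ∈-map⁻ (suc j ∷_) q
    ... | _ , _ , refl | _ , _ , e = i≢j (suc-injective (∷-injectiveˡ e))

  parts≤sum : ∀ π → All (_≤ sum π) π
  parts≤sum []      = []
  parts≤sum (x ∷ π) =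
    m≤m+n x (sum π) ∷ All.map (λ y≤ → ≤-trans y≤ (m≤n+m (sum π) x)) (parts≤sum π)

  length≤sum : ∀ {π} → All (1 ≤_) π → length π ≤ sum π
  length≤sum []         = z≤n
  length≤sum (1≤x ∷ ps) = +-mono-≤ 1≤x (length≤sum ps)

partitions-sound : ∀ {m π} → π ∈ partitions m → IsPartition m π
partitions-sound {m} = proj₁ ∘ sound m m m

partitions-complete : ∀ {m π} → IsPartition m π → π ∈ partitions m
partitions-complete {π = π} P@(isPartition pos _ refl) =
  complete _ _ _ P (parts≤sum π) (length≤sum pos)

partitions-unique : ∀ m → Unique (partitions m)
partitions-unique m = unique m m m

p : ℕ → ℕ
p m = length (partitions m)

occurrences : ℕ → List ℕ → ℕ
occurrences k π = length (filter (k ≟_) π)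

largest : List ℕ → ℕ
largest = max 0

NoOnesLargestRepeated : Pred (List ℕ) _
NoOnesLargestRepeated π = 1 ∉ π × 1 < occurrences (largest π) π

noOnesLargestRepeated? : Decidable NoOnesLargestRepeated
noOnesLargestRepeated? π = (1 ∉? π) ×-dec (1 <? occurrences (largest π) π)

#NoOnesLargestRepeated : ℕ → ℕ
#NoOnesLargestRepeated n = length (filter noOnesLargestRepeated? (partitions n))

-- S r m k is $S^{(r)}_{m,k}$.
S : (r m k : ℕ) → ℕ
S r m k = sum (map (occurrences k) (filter (all? (r ≤?_)) (partitions m)))

HasPrimeSquareDivisor : ℕ → Set
HasPrimeSquareDivisor m = ∃[ q ] Prime q × q * q ∣ m

hasPrimeSquareDivisor? : ∀ m → .{{NonZero m}} → Dec (HasPrimeSquareDivisor m)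
hasPrimeSquareDivisor? m =
  map′ (λ (q , _ , h) → q , h)
       (λ (q , q-prime , q²∣m) →
          q , s≤s (∣⇒≤ (∣-trans (m∣m*n q) q²∣m)) , q-prime , q²∣m)
       (anyUpTo? (λ q → prime? q ×-dec (q * q ∣? m)) (suc m))

-- The value at 0 is a dummy.  In the last branch the list of prime factors
-- has no repetitions, so its length is the number of distinct primes of
-- which m is the product.
μ : ℕ → ℤ
μ zero      = 0ℤ
μ m@(suc _) =
  if does (hasPrimeSquareDivisor? m)
  then 0ℤ
  else -1ℤ ℤ.^ length (factors (factorise m))

μ-primeSquareDivisor : ∀ m → HasPrimeSquareDivisor m → μ m ≡ 0ℤ
μ-primeSquareDivisor zero      _ = refl
μ-primeSquareDivisor m@(suc _) h rewrite dec-true (hasPrimeSquareDivisor? m) h = refl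

private
  product-squarefree : ∀ {qs} → All Prime qs → Unique qs → ¬ HasPrimeSquareDivisor (product qs)
  product-squarefree {qs} primes uniq (q , q-prime , q²∣Π)
    with ∈-∃++ (factorisationHasAllPrimeFactors q-prime (∣-trans (m∣m*n q) q²∣Π) primes)
  ... | ys , zs , refl with AllPairs-resp (shift q ys zs) uniq
    where
    open import Data.List.Relation.Binary.Permutation.Setoid.Properties (setoid ℕ)
      using (Unique-resp-↭)
    AllPairs-resp = λ {xs} {ys} p → Unique-resp-↭ {xs} {ys} (↭⇒↭ₛ p)
  ...   | q∉ ∷ _ = All.lookup q∉ (factorisationHasAllPrimeFactors q-prime q∣Π primes′) refl
    where
    primes′ = All.tail (All-resp-↭ (shift q ys zs) primes)
    q∣Π = *-cancelˡ-∣ q {{prime⇒nonZero q-prime}}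
            (subst (q * q ∣_) (product-↭ (shift q ys zs)) q²∣Π)

μ-distinctPrimes : ∀ m {qs} → All Prime qs → Unique qs → m ≡ product qs →
                   μ m ≡ -1ℤ ℤ.^ length qs
μ-distinctPrimes zero primes _ 0≡Π =
  contradiction (sym 0≡Π) (≢-nonZero⁻¹ _ {{productOfPrimes≢0 primes}})
μ-distinctPrimes m@(suc _) {qs} primes uniq m≡Π
  rewrite dec-false (hasPrimeSquareDivisor? m)
            (subst (¬_ ∘ HasPrimeSquareDivisor) (sym m≡Π) (product-squarefree primes uniq))
  = cong (-1ℤ ℤ.^_) (↭-length (factorisationUnique (factorise m)
      record { factors = qs ; isFactorisation = m≡Π ; factorsPrime = primes }))

{-# OPTIONS --safe #-}
-- Removing a part k ≥ r from the partitions with all parts ≥ r shows that their number P r m satisfies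
-- P (r + 1) m = P r m - P r (m - r), and that S^{(r)}_{m,k} is the sum of P r (m - N) over the positive
-- multiples N ≤ m of k.  Hence Σ_{k ≥ 4} S^{(4)}_{m,k} μ(k) = Σ_N P 4 (m - N) Σ_{k ∣ N, k ≥ 4} μ(k), where
-- the inner sum is [N = 1] - [1 ∣ N] + [2 ∣ N] + [3 ∣ N].  The four resulting sums telescope, and at
-- m = n + 5 the total is -∇²[p](n).
-- For the first equality, raising the largest part by one maps the partitions of n - 1 without
-- ones bijectively to those of n without ones whose largest part occurs exactly once.
module Submission where

open import Defs
open import Data.Nat using (ℕ; _≤_; _+_; _∸_)
open import Data.Integer as ℤ using (+_)
open import Data.Product using (_×_)
open import Relation.Binary.PropositionalEquality using (_≡_)

open import Data.Nat
  using (zero; suc; z≤n; s≤s; s≤s⁻¹; _<_; _≥_; _*_; _≟_; _≤?_; _<?_; NonZero; >-nonZero; >-nonZero⁻¹)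
open import Data.Nat.Coprimality using (Coprime; coprime-divisor)
open import Data.Nat.Induction using (<-rec)
import Data.Nat.Properties as ℕ
open import Data.Nat.Divisibility
open import Data.Nat.ListAction using (sum; product)
open import Data.Nat.ListAction.Properties using (sum-↭; ∈⇒∣product)
open import Data.Nat.Primality
  using (Prime; prime⇒nonZero; prime⇒irreducible; productOfPrimes≥1; ¬prime[1])
open import Data.Nat.Primality.Factorisation using (factorise)
open import Data.Integer using (ℤ; 0ℤ; 1ℤ; -1ℤ)
import Data.Integer.Properties as ℤ
open import Data.Integer.Tactic.RingSolver using (solve-∀)
open import Data.List
  using (List; []; _∷_; _++_; map; filter; foldr; length; applyUpTo)
import Data.List.Properties as List
open import Data.List.Extrema.Nat using (max≈v⁺)
open import Data.List.Membership.Propositional using (_∈_; _∉_)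
open import Data.List.Membership.DecPropositional _≟_ using (_∈?_)
open import Data.List.Membership.Propositional.Properties
  using (∈-map⁺; ∈-map⁻; ∈-filter⁺; ∈-filter⁻; ∈-applyUpTo⁺; ∈-applyUpTo⁻; ∈-∃++)
open import Data.List.Membership.Propositional.Properties.WithK using (unique∧set⇒bag)
open import Data.List.Relation.Binary.BagAndSetEquality using (∼bag⇒↭)
open import Data.List.Relation.Binary.Permutation.Propositional
  using (_↭_; ↭-sym; ↭-trans; ↭⇒↭ₛ)
open import Data.List.Relation.Binary.Permutation.Propositional.Properties
  using (All-resp-↭; ∈-resp-↭; shift; drop-∷; filter-↭; ↭-length)
open import Data.List.Relation.Binary.Pointwise using (Pointwise-≡⇒≡)
open import Data.List.Relation.Unary.All as All using (All; []; _∷_; all?)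
import Data.List.Relation.Unary.All.Properties as All
open import Data.List.Relation.Unary.AllPairs using (AllPairs; []; _∷_)
open import Data.List.Relation.Unary.Any using (here; there)
open import Data.List.Relation.Unary.Linked using (Linked; []; [-]; _∷_)
open import Data.List.Relation.Unary.Linked.Properties using (Linked⇒All; Linked⇒AllPairs; AllPairs⇒Linked)
open import Data.List.Relation.Unary.Unique.Propositional using (Unique)
import Data.List.Relation.Unary.Unique.Propositional.Properties as Unique
open import Data.Product using (_,_; proj₁; proj₂)
open import Data.Sum using (inj₁; inj₂)
open import Function using (_∘_; const)
open import Function.Bundles using (mk⇔)
import Relation.Binary.Properties.DecTotalOrder as DecTotalOrder
open import Relation.Binary.PropositionalEquality
  using (_≢_; refl; sym; trans; cong; cong₂; subst; module ≡-Reasoning)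
open import Relation.Nullary using (¬_; Dec; yes; no; contradiction; ¬?)
open import Relation.Unary using (Decidable)
open DecTotalOrder ℕ.≤-decTotalOrder using (≥-decTotalOrder; ≥-totalOrder)
open import Data.List.Sort ≥-decTotalOrder using (sort; sort-↭; sort-↗)
open import Data.List.Relation.Unary.Sorted.TotalOrder.Properties using (↗↭↗⇒≋)

open IsPartition

private variable
  A B : Set

-- Integer sums over lists, and lists up to permutation

∑ : List A → (A → ℤ) → ℤ
∑ xs f = foldr ℤ._+_ 0ℤ (map f xs)

syntax ∑ xs (λ x → e) = ∑[ x ∈ xs ] e

∑-cong : ∀ {f g : A → ℤ} xs → (∀ {x} → x ∈ xs → f x ≡ g x) → ∑ xs f ≡ ∑ xs g
∑-cong []       _  = refl
∑-cong (x ∷ xs) eq = cong₂ ℤ._+_ (eq (here refl)) (∑-cong xs (eq ∘ there))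

∑-zero : ∀ {f : A → ℤ} xs → (∀ {x} → x ∈ xs → f x ≡ 0ℤ) → ∑ xs f ≡ 0ℤ
∑-zero []       _  = refl
∑-zero (x ∷ xs) eq = cong₂ ℤ._+_ (eq (here refl)) (∑-zero xs (eq ∘ there))

∑-map : ∀ (g : A → B) {f : B → ℤ} xs → ∑ (map g xs) f ≡ ∑ xs (f ∘ g)
∑-map g {f} xs = cong (foldr ℤ._+_ 0ℤ) (sym (List.map-∘ xs))

∑-+ : ∀ (f g : A → ℤ) xs → ∑[ x ∈ xs ] (f x ℤ.+ g x) ≡ ∑ xs f ℤ.+ ∑ xs g
∑-+ f g []       = refl
∑-+ f g (x ∷ xs) =
  trans (cong (ℤ._+_ (f x ℤ.+ g x)) (∑-+ f g xs)) (interchange (f x) (g x) (∑ xs f) (∑ xs g))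
  where
  interchange : ∀ a b c d → a ℤ.+ b ℤ.+ (c ℤ.+ d) ≡ a ℤ.+ c ℤ.+ (b ℤ.+ d)
  interchange = solve-∀

∑-*ˡ : ∀ c (f : A → ℤ) xs → ∑[ x ∈ xs ] (c ℤ.* f x) ≡ c ℤ.* ∑ xs f
∑-*ˡ c f []       = sym (ℤ.*-zeroʳ c)
∑-*ˡ c f (x ∷ xs) = trans (cong (ℤ._+_ (c ℤ.* f x)) (∑-*ˡ c f xs)) (sym (ℤ.*-distribˡ-+ c (f x) (∑ xs f)))

∑-*ʳ : ∀ c (f : A → ℤ) xs → ∑[ x ∈ xs ] (f x ℤ.* c) ≡ ∑ xs f ℤ.* c
∑-*ʳ c f []       = refl
∑-*ʳ c f (x ∷ xs) = trans (cong (ℤ._+_ (f x ℤ.* c)) (∑-*ʳ c f xs)) (sym (ℤ.*-distribʳ-+ c (f x) (∑ xs f)))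

∑-neg : ∀ (f : A → ℤ) xs → ∑[ x ∈ xs ] (ℤ.- f x) ≡ ℤ.- ∑ xs f
∑-neg f []       = refl
∑-neg f (x ∷ xs) = trans (cong (ℤ._+_ (ℤ.- f x)) (∑-neg f xs)) (sym (ℤ.neg-distrib-+ (f x) (∑ xs f)))

∑-swap : ∀ (f : A → B → ℤ) xs ys → ∑[ x ∈ xs ] (∑[ y ∈ ys ] f x y) ≡ ∑[ y ∈ ys ] (∑[ x ∈ xs ] f x y)
∑-swap f []       ys = sym (∑-zero ys λ _ → refl)
∑-swap f (x ∷ xs) ys = trans (cong (ℤ._+_ (∑ ys (f x))) (∑-swap f xs ys))
                               (sym (∑-+ (f x) (λ y → ∑[ x′ ∈ xs ] f x′ y) ys))

∑-↭ : ∀ (f : A → ℤ) {xs ys} → xs ↭ ys → ∑ xs f ≡ ∑ ys f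
∑-↭ f _↭_.refl = refl
∑-↭ f (_↭_.prep x p) = cong (ℤ._+_ (f x)) (∑-↭ f p)
∑-↭ f (_↭_.swap {xs} {ys} x y p) =
  trans (cong (λ s → f x ℤ.+ (f y ℤ.+ s)) (∑-↭ f p)) (comm (f x) (f y) (∑ ys f))
  where
  comm : ∀ a b c → a ℤ.+ (b ℤ.+ c) ≡ b ℤ.+ (a ℤ.+ c)
  comm = solve-∀
∑-↭ f (_↭_.trans p q) = trans (∑-↭ f p) (∑-↭ f q)

∑-split : ∀ {P : A → Set} (P? : Decidable P) (f : A → ℤ) xs →
          ∑ xs f ≡ ∑ (filter P? xs) f ℤ.+ ∑ (filter (¬? ∘ P?) xs) f
∑-split P? f [] = refl
∑-split P? f (x ∷ xs) with P? x
... | yes _ = trans (cong (ℤ._+_ (f x)) (∑-split P? f xs)) (sym (ℤ.+-assoc (f x) _ _))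
... | no _  = trans (cong (ℤ._+_ (f x)) (∑-split P? f xs)) (swapˡ (f x) (∑ (filter P? xs) f) _)
  where
  swapˡ : ∀ a b c → a ℤ.+ (b ℤ.+ c) ≡ b ℤ.+ (a ℤ.+ c)
  swapˡ = solve-∀

𝟙 : ∀ {P : Set} → Dec P → ℤ
𝟙 (yes _) = 1ℤ
𝟙 (no _)  = 0ℤ

𝟙-no : ∀ {P : Set} (P? : Dec P) → ¬ P → 𝟙 P? ≡ 0ℤ
𝟙-no (yes p) ¬p = contradiction p ¬p
𝟙-no (no _)  _  = refl

∑-filter : ∀ {P : A → Set} (P? : Decidable P) (f : A → ℤ) xs →
           ∑ (filter P? xs) f ≡ ∑[ x ∈ xs ] (𝟙 (P? x) ℤ.* f x)
∑-filter P? f [] = refl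
∑-filter P? f (x ∷ xs) with P? x
... | yes _ = cong₂ ℤ._+_ (sym (ℤ.*-identityˡ (f x))) (∑-filter P? f xs)
... | no _  = trans (∑-filter P? f xs) (sym (ℤ.+-identityˡ _))

∑-1 : ∀ (xs : List A) → ∑ xs (const 1ℤ) ≡ + length xs
∑-1 []       = refl
∑-1 (x ∷ xs) = cong (ℤ._+_ 1ℤ) (∑-1 xs)

∑-pos : ∀ (f : A → ℕ) xs → ∑[ x ∈ xs ] (+ f x) ≡ + sum (map f xs)
∑-pos f []       = refl
∑-pos f (x ∷ xs) = cong (ℤ._+_ (+ f x)) (∑-pos f xs)

-- Every bijection and every regrouping of an index set below ends here: only membership in both
-- directions remains to be shown, and `∑-↭` then carries the sums across.
unique∧set⇒↭ : ∀ {xs ys : List A} → Unique xs → Unique ys →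
               (∀ {x} → x ∈ xs → x ∈ ys) → (∀ {x} → x ∈ ys → x ∈ xs) → xs ↭ ys
unique∧set⇒↭ xs! ys! to from = ∼bag⇒↭ (unique∧set⇒bag xs! ys! (mk⇔ to from))

-- Injectivity is asked only on the members of the list: `addPart k` forgets the order of its
-- argument, so it is injective on partitions but not on all lists.
map-unique : ∀ {f : A → B} {xs} → (∀ {x y} → x ∈ xs → y ∈ xs → f x ≡ f y → x ≡ y) →
             Unique xs → Unique (map f xs)
map-unique inj []         = []
map-unique {f = f} {x ∷ xs} inj (x∉ ∷ xs!) =
  All.tabulate (λ y∈ fx≡y → let (z , z∈ , y≡fz) = ∈-map⁻ f y∈ in
    All.lookup x∉ z∈ (inj (here refl) (there z∈) (trans fx≡y y≡fz)))
  ∷ map-unique (λ x∈ y∈ → inj (there x∈) (there y∈)) xs!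

-- Partitions with smallest part at least r

Q : ℕ → ℕ → List (List ℕ)
Q r m = filter (all? (r ≤?_)) (partitions m)

P : ℕ → ℕ → ℤ
P r m = + length (Q r m)

Q! : ∀ r m → Unique (Q r m)
Q! r m = Unique.filter⁺ (all? (r ≤?_)) (partitions-unique m)

∈-Q⁺ : ∀ {r m π} → IsPartition m π → All (r ≤_) π → π ∈ Q r m
∈-Q⁺ {r} π⊢m r≤π = ∈-filter⁺ (all? (r ≤?_)) (partitions-complete π⊢m) r≤π

∈-Q⁻ : ∀ r m {π} → π ∈ Q r m → IsPartition m π × All (r ≤_) π
∈-Q⁻ r m π∈ = let (π∈p , r≤π) = ∈-filter⁻ (all? (r ≤?_)) {xs = partitions m} π∈
             in partitions-sound π∈p , r≤π

-- A multiset has a single weakly decreasing arrangement, so equality of partitions may be checked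
-- up to permutation.
decreasing-↭⇒≡ : ∀ {xs ys} → Linked _≥_ xs → Linked _≥_ ys → xs ↭ ys → xs ≡ ys
decreasing-↭⇒≡ xs↘ ys↘ xs↭ys =
  Pointwise-≡⇒≡ (↗↭↗⇒≋ ≥-totalOrder xs↘ ys↘ (↭⇒↭ₛ xs↭ys))

-- Sorting puts `k` in its place among the parts, so that only `sort-↭` and `sort-↗` are needed and
-- no position of insertion is ever computed.
addPart : ℕ → List ℕ → List ℕ
addPart k π = sort (k ∷ π)

addPart-↭ : ∀ k π → addPart k π ↭ k ∷ π
addPart-↭ k π = sort-↭ (k ∷ π)

≥-trans : ∀ {x y z} → x ≥ y → y ≥ z → x ≥ z
≥-trans x≥y y≥z = ℕ.≤-trans y≥z x≥y

-- Deleting an element makes new neighbours, which `Linked` says nothing about directly; `AllPairs`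
-- already relates them.
AllPairs-remove : ∀ {R : A → A → Set} xs {y ys} → AllPairs R (xs ++ y ∷ ys) → AllPairs R (xs ++ ys)
AllPairs-remove []       (_ ∷ ps) = ps
AllPairs-remove (x ∷ xs) (p ∷ ps) =
  All.++⁺ (All.++⁻ˡ xs p) (All.tail (All.++⁻ʳ xs p)) ∷ AllPairs-remove xs ps

-- The inverse deletes one copy of `k`. Adding `k` keeps the parts positive by `1 ≤ k` and at least
-- `r` by `r ≤ k`.
addPart-bijection : ∀ {r k} m → 1 ≤ k → r ≤ k →
                    filter (k ∈?_) (Q r (k + m)) ↭ map (addPart k) (Q r m)
addPart-bijection {r} {k} m 1≤k r≤k =
  unique∧set⇒↭ (Unique.filter⁺ (k ∈?_) (Q! r (k + m))) (map-unique injective (Q! r m)) to from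
  where
  injective : ∀ {π ρ} → π ∈ Q r m → ρ ∈ Q r m → addPart k π ≡ addPart k ρ → π ≡ ρ
  injective {π} {ρ} π∈ ρ∈ eq =
    decreasing-↭⇒≡ (decreasing (proj₁ (∈-Q⁻ r m π∈))) (decreasing (proj₁ (∈-Q⁻ r m ρ∈)))
      (drop-∷ (↭-trans (↭-sym (addPart-↭ k π)) (subst (_↭ k ∷ ρ) (sym eq) (addPart-↭ k ρ))))

  from : ∀ {π} → π ∈ map (addPart k) (Q r m) → π ∈ filter (k ∈?_) (Q r (k + m))
  from π∈ with ρ , ρ∈ , refl ← ∈-map⁻ (addPart k) π∈ =
    let isPartition pos _ tot , r≤ρ = ∈-Q⁻ r m ρ∈
        k∷ρ↭ = ↭-sym (addPart-↭ k ρ)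
    in ∈-filter⁺ (k ∈?_)
         (∈-Q⁺ (isPartition (All-resp-↭ k∷ρ↭ (1≤k ∷ pos)) (sort-↗ (k ∷ ρ))
                  (trans (sum-↭ (addPart-↭ k ρ)) (cong (_+_ k) tot)))
               (All-resp-↭ k∷ρ↭ (r≤k ∷ r≤ρ)))
         (∈-resp-↭ k∷ρ↭ (here refl))

  to : ∀ {π} → π ∈ filter (k ∈?_) (Q r (k + m)) → π ∈ map (addPart k) (Q r m)
  to {π} π∈ with π∈Q , k∈π ← ∈-filter⁻ (k ∈?_) {xs = Q r (k + m)} π∈
            with ys , zs , refl ← ∈-∃++ k∈π
            with isPartition pos dec tot , r≤π ← ∈-Q⁻ r (k + m) π∈Q =
    -- The preimage is `ys ++ zs`: sorting `k` back in yields a decreasing arrangement of the parts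
    -- of the given partition, hence that partition itself.
    subst (_∈ map (addPart k) (Q r m))
      (decreasing-↭⇒≡ (sort-↗ (k ∷ ys ++ zs)) dec (↭-trans (addPart-↭ k (ys ++ zs)) (↭-sym π↭)))
      (∈-map⁺ (addPart k) (∈-Q⁺
        (isPartition (All.tail (All-resp-↭ π↭ pos))
          (AllPairs⇒Linked (AllPairs-remove ys (Linked⇒AllPairs ≥-trans dec)))
          (ℕ.+-cancelˡ-≡ k _ m (trans (sym (sum-↭ π↭)) tot)))
        (All.tail (All-resp-↭ π↭ r≤π))))
    where
    π↭ : ys ++ k ∷ zs ↭ k ∷ ys ++ zs
    π↭ = shift k ys zs

≡+⇒≡- : ∀ {a} b c → a ≡ b ℤ.+ c → b ≡ a ℤ.- c
≡+⇒≡- b c refl = cancel b c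
  where
  cancel : ∀ b c → b ≡ b ℤ.+ c ℤ.- c
  cancel = solve-∀

-- The partitions of `r + m` with parts at least `r` split by whether `r` occurs. Those with `r`
-- arise from partitions of `m` by adding it; those without have all parts at least `suc r`.
P-suc : ∀ r m → 1 ≤ r → P (suc r) (r + m) ≡ P r (r + m) ℤ.- P r m
P-suc r m 1≤r = ≡+⇒≡- (P (suc r) (r + m)) (P r m) (begin
  P r (r + m)                             ≡⟨ ∑-1 (Q r (r + m)) ⟨
  ∑ (Q r (r + m)) (const 1ℤ)              ≡⟨ ∑-split (r ∈?_) (const 1ℤ) (Q r (r + m)) ⟩
  ∑ with-r (const 1ℤ) ℤ.+ ∑ without-r (const 1ℤ)
    ≡⟨ cong₂ ℤ._+_ (∑-↭ (const 1ℤ) (addPart-bijection {r} m 1≤r ℕ.≤-refl)) (∑-↭ (const 1ℤ) without-r↭) ⟩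
  ∑ (map (addPart r) (Q r m)) (const 1ℤ) ℤ.+ ∑ (Q (suc r) (r + m)) (const 1ℤ)
    ≡⟨ cong₂ ℤ._+_ (trans (∑-map (addPart r) (Q r m)) (∑-1 (Q r m))) (∑-1 (Q (suc r) (r + m))) ⟩
  P r m ℤ.+ P (suc r) (r + m)             ≡⟨ ℤ.+-comm (P r m) (P (suc r) (r + m)) ⟩
  P (suc r) (r + m) ℤ.+ P r m             ∎)
  where
  open ≡-Reasoning
  with-r    = filter (r ∈?_) (Q r (r + m))
  without-r = filter (¬? ∘ (r ∈?_)) (Q r (r + m))

  without-r↭ : without-r ↭ Q (suc r) (r + m)
  without-r↭ = unique∧set⇒↭ (Unique.filter⁺ (¬? ∘ (r ∈?_)) (Q! r (r + m))) (Q! (suc r) (r + m))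
    (λ π∈ → let (π∈Q , r∉π) = ∈-filter⁻ (¬? ∘ (r ∈?_)) {xs = Q r (r + m)} π∈
                (π⊢ , r≤π)   = ∈-Q⁻ r (r + m) π∈Q
            in ∈-Q⁺ π⊢ (All.tabulate λ x∈π → ℕ.≤∧≢⇒< (All.lookup r≤π x∈π) λ { refl → r∉π x∈π }))
    (λ π∈ → let (π⊢ , r<π) = ∈-Q⁻ (suc r) (r + m) π∈
            in ∈-filter⁺ (¬? ∘ (r ∈?_)) (∈-Q⁺ π⊢ (All.map ℕ.<⇒≤ r<π))
                 (λ r∈π → ℕ.<-irrefl refl (All.lookup r<π r∈π)))

-- Occurrences of a part, and the recursion for `S`

∉⇒occurrences≡0 : ∀ {k π} → k ∉ π → occurrences k π ≡ 0
∉⇒occurrences≡0 {k} {π} k∉π =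
  cong length (List.filter-none (k ≟_) {xs = π} (All.tabulate λ { x∈π refl → k∉π x∈π }))

occurrences-↭ : ∀ k {π ρ} → π ↭ ρ → occurrences k π ≡ occurrences k ρ
occurrences-↭ k π↭ρ = ↭-length (filter-↭ (k ≟_) π↭ρ)

occurrences-∷ : ∀ k π → occurrences k (k ∷ π) ≡ suc (occurrences k π)
occurrences-∷ k π = cong length (List.filter-accept (k ≟_) {xs = π} refl)

-- Partitions without `k` contribute nothing. Each other one is `addPart k π` and has one occurrence
-- more than `π`; these extra occurrences number `P r m`.
S-rec : ∀ {r k} m → 1 ≤ k → r ≤ k → + S r (k + m) k ≡ P r m ℤ.+ + S r m k
S-rec {r} {k} m 1≤k r≤k = begin
  + S r (k + m) k                          ≡⟨ ∑-pos (occurrences k) (Q r (k + m)) ⟨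
  ∑ (Q r (k + m)) occ                      ≡⟨ ∑-split (k ∈?_) occ (Q r (k + m)) ⟩
  ∑ (filter (k ∈?_) (Q r (k + m))) occ ℤ.+ ∑ (filter (¬? ∘ (k ∈?_)) (Q r (k + m))) occ
    ≡⟨ cong₂ ℤ._+_ (∑-↭ occ (addPart-bijection {r} m 1≤k r≤k))
         (∑-zero _ λ {π} π∈ →
           cong +_ (∉⇒occurrences≡0 {k} {π} (proj₂ (∈-filter⁻ (¬? ∘ (k ∈?_)) {xs = Q r (k + m)} π∈)))) ⟩
  ∑ (map (addPart k) (Q r m)) occ ℤ.+ 0ℤ   ≡⟨ ℤ.+-identityʳ _ ⟩
  ∑ (map (addPart k) (Q r m)) occ          ≡⟨ ∑-map (addPart k) (Q r m) ⟩
  ∑ (Q r m) (occ ∘ addPart k)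
    ≡⟨ ∑-cong (Q r m) (λ {π} _ → cong +_ (trans (occurrences-↭ k (addPart-↭ k π)) (occurrences-∷ k π))) ⟩
  ∑[ π ∈ Q r m ] (1ℤ ℤ.+ occ π)            ≡⟨ ∑-+ (const 1ℤ) occ (Q r m) ⟩
  ∑ (Q r m) (const 1ℤ) ℤ.+ ∑ (Q r m) occ   ≡⟨ cong₂ ℤ._+_ (∑-1 (Q r m)) (∑-pos (occurrences k) (Q r m)) ⟩
  P r m ℤ.+ + S r m k                      ∎
  where
  open ≡-Reasoning
  occ : List ℕ → ℤ
  occ π = + occurrences k π

∈⇒≤sum : ∀ {x xs} → x ∈ xs → x ≤ sum xs
∈⇒≤sum {xs = x ∷ xs} (here refl) = ℕ.m≤m+n x (sum xs)
∈⇒≤sum {xs = x ∷ xs} (there x∈)  = ℕ.≤-trans (∈⇒≤sum x∈) (ℕ.m≤n+m (sum xs) x)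

S-small : ∀ {r m k} → m < k → + S r m k ≡ 0ℤ
S-small {r} {m} {k} m<k = trans (sym (∑-pos (occurrences k) (Q r m)))
  (∑-zero (Q r m) λ {π} π∈ → cong +_ (∉⇒occurrences≡0 {k} {π} λ k∈π →
    ℕ.<⇒≱ m<k (subst (k ≤_) (total (proj₁ (∈-Q⁻ r m π∈))) (∈⇒≤sum k∈π))))

-- Partitions whose largest part is not repeated

LargestRepeated? : Decidable (λ π → 1 < occurrences (largest π) π)
LargestRepeated? π = 1 <? occurrences (largest π) π

largest-∷ : ∀ {x π} → Linked _≥_ (x ∷ π) → largest (x ∷ π) ≡ x
largest-∷ dec =
  max≈v⁺ (here refl) (Linked⇒All ≥-trans ℕ.≤-refl dec) z≤n

occurrences-largest : ∀ {x π} → Linked _≥_ (x ∷ π) →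
                      occurrences (largest (x ∷ π)) (x ∷ π) ≡ suc (occurrences x π)
occurrences-largest {x} {π} dec =
  trans (cong (λ k → occurrences k (x ∷ π)) (largest-∷ dec)) (occurrences-∷ x π)

raiseLargest : List ℕ → List ℕ
raiseLargest []      = []
raiseLargest (x ∷ π) = suc x ∷ π

raiseLargest-injective : ∀ {π ρ} → raiseLargest π ≡ raiseLargest ρ → π ≡ ρ
raiseLargest-injective {[]}    {[]}    _    = refl
raiseLargest-injective {_ ∷ _} {_ ∷ _} refl = refl

-- A raised first part exceeds all others, so it occurs once. Conversely, an unrepeated largest part
-- is strictly above the next part, so lowering it by one keeps the list decreasing.
raiseLargest-bijection : ∀ n → 2 ≤ n →
  filter (¬? ∘ LargestRepeated?) (Q 2 (suc n)) ↭ map raiseLargest (Q 2 n)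
raiseLargest-bijection n 2≤n =
  unique∧set⇒↭ (Unique.filter⁺ (¬? ∘ LargestRepeated?) (Q! 2 (suc n)))
               (map-unique (λ _ _ → raiseLargest-injective) (Q! 2 n)) to from
  where
  link-suc : ∀ {x π} → Linked _≥_ (x ∷ π) → Linked _≥_ (suc x ∷ π)
  link-suc [-]       = [-]
  link-suc (x≥y ∷ l) = ℕ.m≤n⇒m≤1+n x≥y ∷ l

  raised : ∀ {π} → IsPartition n π → All (2 ≤_) π →
           raiseLargest π ∈ filter (¬? ∘ LargestRepeated?) (Q 2 (suc n))
  raised {[]} (isPartition _ _ refl) _ = contradiction 2≤n λ ()
  raised {x ∷ π} (isPartition (1≤x ∷ pos) dec tot) (2≤x ∷ 2≤π) =
    ∈-filter⁺ (¬? ∘ LargestRepeated?)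
      (∈-Q⁺ (isPartition (s≤s z≤n ∷ pos) (link-suc dec) (cong suc tot)) (ℕ.m≤n⇒m≤1+n 2≤x ∷ 2≤π))
      (λ 1<occ → ℕ.<-irrefl refl (subst (1 <_)
        (trans (occurrences-largest (link-suc dec)) (cong suc (∉⇒occurrences≡0 {suc x} {π} sx∉π))) 1<occ))
    where
    sx∉π : suc x ∉ π
    sx∉π sx∈π = ℕ.<-irrefl refl
      (All.lookup (All.tail (Linked⇒All ≥-trans (ℕ.≤-refl {x}) dec)) sx∈π)

  from : ∀ {π} → π ∈ map raiseLargest (Q 2 n) → π ∈ filter (¬? ∘ LargestRepeated?) (Q 2 (suc n))
  from π∈ with ρ , ρ∈ , refl ← ∈-map⁻ raiseLargest π∈ =
    let ρ⊢n , 2≤ρ = ∈-Q⁻ 2 n ρ∈ in raised ρ⊢n 2≤ρ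

  unrepeated : ∀ {x π} → Linked _≥_ (x ∷ π) →
               ¬ 1 < occurrences (largest (x ∷ π)) (x ∷ π) → x ∉ π
  unrepeated {x} {π} dec ¬rep x∈π =
    ¬rep (subst (1 <_) (sym (occurrences-largest dec)) (s≤s (List.filter-some (x ≟_) x∈π)))

  lowered : ∀ {π} → IsPartition (suc n) π → All (2 ≤_) π →
            ¬ 1 < occurrences (largest π) π → π ∈ map raiseLargest (Q 2 n)
  lowered {[]} (isPartition _ _ ()) _ _
  lowered {zero ∷ _} (isPartition (() ∷ _) _ _) _ _
  -- A single part has no neighbour to bound it from below; it is lowered to `n` itself, and `2 ≤ n`
  -- prevents a part 1.
  lowered {suc y ∷ []} (isPartition (_ ∷ pos) dec tot) _ _ =
    ∈-map⁺ raiseLargest (∈-Q⁺ (isPartition (ℕ.≤-trans (s≤s z≤n) 2≤y ∷ []) [-] (ℕ.suc-injective tot))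
                              (2≤y ∷ []))
    where
    2≤y : 2 ≤ y
    2≤y = subst (2 ≤_) (trans (sym (ℕ.suc-injective tot)) (ℕ.+-identityʳ y)) 2≤n
  -- Here the second part `z` bounds the lowered one: `z ≢ suc y` gives `z ≤ y`, and `2 ≤ z` gives
  -- `2 ≤ y`.
  lowered {suc y ∷ z ∷ π} (isPartition (_ ∷ pos) dec@(sy≥z ∷ dec′) tot) (_ ∷ 2≤z ∷ 2≤π) ¬rep =
    ∈-map⁺ raiseLargest (∈-Q⁺ (isPartition (ℕ.≤-trans (s≤s z≤n) 2≤y ∷ pos) (z≤y ∷ dec′) (ℕ.suc-injective tot))
                              (2≤y ∷ 2≤z ∷ 2≤π))
    where
    z≤y : z ≤ y
    z≤y = s≤s⁻¹ (ℕ.≤∧≢⇒< sy≥z λ z≡sy → unrepeated dec ¬rep (here (sym z≡sy)))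

    2≤y : 2 ≤ y
    2≤y = ℕ.≤-trans 2≤z z≤y

  to : ∀ {π} → π ∈ filter (¬? ∘ LargestRepeated?) (Q 2 (suc n)) → π ∈ map raiseLargest (Q 2 n)
  to π∈ = let π∈Q , ¬rep = ∈-filter⁻ (¬? ∘ LargestRepeated?) {xs = Q 2 (suc n)} π∈
              π⊢ , 2≤π = ∈-Q⁻ 2 (suc n) π∈Q
          in lowered π⊢ 2≤π ¬rep

-- Among the partitions of `suc n` without ones, those with unrepeated largest part are counted by
-- `P 2 n`; the repeated case is the remainder.
#NoOnesLargestRepeated-P₂ : ∀ n → 2 ≤ n → + #NoOnesLargestRepeated (suc n) ≡ P 2 (suc n) ℤ.- P 2 n
#NoOnesLargestRepeated-P₂ n 2≤n = ≡+⇒≡- (+ #NoOnesLargestRepeated (suc n)) (P 2 n) (begin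
  P 2 (suc n)                                               ≡⟨ ∑-1 (Q 2 (suc n)) ⟨
  ∑ (Q 2 (suc n)) (const 1ℤ)                                ≡⟨ ∑-split LargestRepeated? (const 1ℤ) (Q 2 (suc n)) ⟩
  ∑ (filter LargestRepeated? (Q 2 (suc n))) (const 1ℤ)
  ℤ.+ ∑ (filter (¬? ∘ LargestRepeated?) (Q 2 (suc n))) (const 1ℤ)
    ≡⟨ cong₂ ℤ._+_ (trans (∑-↭ (const 1ℤ) repeated↭) (∑-1 (filter noOnesLargestRepeated? (partitions (suc n)))))
         (trans (∑-↭ (const 1ℤ) (raiseLargest-bijection n 2≤n))
           (trans (∑-map raiseLargest (Q 2 n)) (∑-1 (Q 2 n)))) ⟩
  + #NoOnesLargestRepeated (suc n) ℤ.+ P 2 n                ∎)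
  where
  open ≡-Reasoning

  repeated↭ : filter LargestRepeated? (Q 2 (suc n)) ↭ filter noOnesLargestRepeated? (partitions (suc n))
  repeated↭ = unique∧set⇒↭ (Unique.filter⁺ LargestRepeated? (Q! 2 (suc n)))
    (Unique.filter⁺ noOnesLargestRepeated? (partitions-unique (suc n)))
    (λ π∈ → let π∈Q , rep = ∈-filter⁻ LargestRepeated? {xs = Q 2 (suc n)} π∈
                π⊢ , 2≤π = ∈-Q⁻ 2 (suc n) π∈Q
            in ∈-filter⁺ noOnesLargestRepeated? (partitions-complete π⊢)
                 ((λ 1∈π → ℕ.<-irrefl refl (All.lookup 2≤π 1∈π)) , rep))
    (λ π∈ → let π∈p , 1∉π , rep = ∈-filter⁻ noOnesLargestRepeated? {xs = partitions (suc n)} π∈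
                π⊢ = partitions-sound {suc n} π∈p
            in ∈-filter⁺ LargestRepeated?
                 (∈-Q⁺ {m = suc n} π⊢ (All.tabulate λ x∈π →
                   ℕ.≤∧≢⇒< (All.lookup (positive π⊢) x∈π) λ { refl → 1∉π x∈π }))
                 rep)

-- Sums of f (m ∸ N) over the positive multiples N of k up to m

range : ℕ → List ℕ
range m = applyUpTo suc m

range! : ∀ m → Unique (range m)
range! m = Unique.applyUpTo⁺₁ suc m λ i<j _ → ℕ.<⇒≢ (s≤s i<j)

∈-range⁺ : ∀ {m x} → 1 ≤ x → x ≤ m → x ∈ range m
∈-range⁺ (s≤s _) x≤m = ∈-applyUpTo⁺ suc x≤m

∈-range⁻ : ∀ {m x} → x ∈ range m → 1 ≤ x × x ≤ m
∈-range⁻ x∈ with _ , i<m , refl ← ∈-applyUpTo⁻ suc x∈ = s≤s z≤n , i<m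

T : ℕ → (ℕ → ℤ) → ℕ → ℤ
T k f m = ∑[ N ∈ filter (k ∣?_) (range m) ] f (m ∸ N)

T-small : ∀ {k f m} → m < k → T k f m ≡ 0ℤ
T-small {k} {f} {m} m<k = ∑-zero _ λ N∈ →
  let N∈range , k∣N = ∈-filter⁻ (k ∣?_) {xs = range m} N∈
      1≤N , N≤m = ∈-range⁻ N∈range
  in contradiction (ℕ.≤-trans (∣⇒≤ {{>-nonZero 1≤N}} k∣N) N≤m) (ℕ.<⇒≱ m<k)

-- The multiple `k` itself contributes `f m`; every further multiple is `k + N` with `N` a positive
-- multiple up to `m`, and the shift by `k` cancels in the argument of `f`.
T-rec : ∀ {k} f m → 1 ≤ k → T k f (k + m) ≡ f m ℤ.+ T k f m
T-rec {k} f m 1≤k = begin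
  T k f (k + m)                                        ≡⟨ ∑-↭ (λ N → f (k + m ∸ N)) multiples↭ ⟩
  ∑[ N ∈ k ∷ map (_+_ k) multiples ] f (k + m ∸ N)
    ≡⟨ cong₂ ℤ._+_ (cong f (ℕ.m+n∸m≡n k m)) (∑-map (_+_ k) multiples) ⟩
  f m ℤ.+ ∑[ N ∈ multiples ] f (k + m ∸ (k + N))
    ≡⟨ cong (ℤ._+_ (f m)) (∑-cong multiples λ {N} _ → cong f (ℕ.[m+n]∸[m+o]≡n∸o k m N)) ⟩
  f m ℤ.+ T k f m                                      ∎
  where
  open ≡-Reasoning
  multiples = filter (k ∣?_) (range m)

  multiples↭ : filter (k ∣?_) (range (k + m)) ↭ k ∷ map (_+_ k) multiples
  multiples↭ = unique∧set⇒↭ (Unique.filter⁺ (k ∣?_) (range! (k + m)))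
    (All.tabulate k≢ ∷ Unique.map⁺ (ℕ.+-cancelˡ-≡ k _ _) (Unique.filter⁺ (k ∣?_) (range! m))) to from
    where
    k≢ : ∀ {N} → N ∈ map (_+_ k) multiples → k ≢ N
    k≢ N∈ k≡N with N′ , N′∈ , refl ← ∈-map⁻ (_+_ k) N∈
      with 1≤N′ , _ ← ∈-range⁻ (proj₁ (∈-filter⁻ (k ∣?_) {xs = range m} N′∈)) =
      ℕ.<⇒≢ (ℕ.m<m+n k 1≤N′) k≡N

    to : ∀ {N} → N ∈ filter (k ∣?_) (range (k + m)) → N ∈ k ∷ map (_+_ k) multiples
    to {N} N∈ with N∈range , k∣N ← ∈-filter⁻ (k ∣?_) {xs = range (k + m)} N∈
              with 1≤N , N≤k+m ← ∈-range⁻ N∈range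
              with N ≟ k
    ... | yes refl = here refl
    ... | no N≢k = there (subst (_∈ map (_+_ k) multiples) (ℕ.m+[n∸m]≡n k≤N)
      (∈-map⁺ (_+_ k) (∈-filter⁺ (k ∣?_)
        (∈-range⁺ (ℕ.m<n⇒0<n∸m (ℕ.≤∧≢⇒< k≤N (N≢k ∘ sym))) (ℕ.m≤n+o⇒m∸n≤o N k N≤k+m))
        (∣m+n∣m⇒∣n (subst (k ∣_) (sym (ℕ.m+[n∸m]≡n k≤N)) k∣N) ∣-refl))))
      where
      k≤N : k ≤ N
      k≤N = ∣⇒≤ {{>-nonZero 1≤N}} k∣N

    from : ∀ {N} → N ∈ k ∷ map (_+_ k) multiples → N ∈ filter (k ∣?_) (range (k + m))
    from (here refl) = ∈-filter⁺ (k ∣?_) (∈-range⁺ 1≤k (ℕ.m≤m+n k m)) ∣-refl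
    from (there N∈) with N′ , N′∈ , refl ← ∈-map⁻ (_+_ k) N∈ =
      let N′∈range , k∣N′ = ∈-filter⁻ (k ∣?_) {xs = range m} N′∈
          1≤N′ , N′≤m = ∈-range⁻ N′∈range
      in ∈-filter⁺ (k ∣?_) (∈-range⁺ (ℕ.≤-trans 1≤N′ (ℕ.m≤n+m N′ k)) (ℕ.+-monoʳ-≤ k N′≤m))
           (∣m∣n⇒∣m+n ∣-refl k∣N′)

-- Induction along residue classes modulo `k`, matching the recursions `S-rec` and `T-rec`.
stepInduction : ∀ {P : ℕ → Set} k → 1 ≤ k →
                (∀ m → m < k → P m) → (∀ m → P m → P (k + m)) → ∀ m → P m
stepInduction {P} k 1≤k base step = <-rec P go
  where
  go : ∀ m → (∀ {i} → i < m → P i) → P m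
  go m rec with m <? k
  ... | yes m<k = base m m<k
  ... | no m≮k = subst P (ℕ.m+[n∸m]≡n k≤m)
    -- The inequality obtained is `m ∸ k < m ∸ 0`, whose right side reduces to `m`.
    (step (m ∸ k) (rec (ℕ.∸-monoʳ-< {m} {k} {0} 1≤k k≤m)))
    where
    k≤m : k ≤ m
    k≤m = ℕ.≮⇒≥ m≮k

-- Both sides vanish for `m < k` and grow by `P r m` in passing from `m` to `k + m`.
S≡T : ∀ {r k} → 1 ≤ k → r ≤ k → ∀ m → + S r m k ≡ T k (P r) m
S≡T {r} {k} 1≤k r≤k = stepInduction k 1≤k
  (λ m m<k → trans (S-small {r} {m} m<k) (sym (T-small {k} {P r} {m} m<k)))
  (λ m eq → trans (S-rec m 1≤k r≤k) (trans (cong (ℤ._+_ (P r m)) eq) (sym (T-rec (P r) m 1≤k))))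

-- The Möbius function

-- A prime listed twice would have its square dividing the product.
squarefree⇒unique : ∀ {qs} → All Prime qs → ¬ HasPrimeSquareDivisor (product qs) → Unique qs
squarefree⇒unique [] _ = []
squarefree⇒unique {q ∷ qs} (q-prime ∷ primes) sqfree =
  All.tabulate (λ x∈ → λ { refl → sqfree (q , q-prime , *-monoʳ-∣ q (∈⇒∣product x∈)) })
  ∷ squarefree⇒unique primes λ (x , x-prime , x²∣) → sqfree (x , x-prime , ∣n⇒∣m*n q x²∣)

μ-∣ : ∀ {q e} → Prime q → q ∣ e → μ (q * e) ≡ 0ℤ
μ-∣ {q} {e} q-prime q∣e = μ-primeSquareDivisor (q * e) (q , q-prime , *-monoʳ-∣ q q∣e)

μ-∤ : ∀ {q} e → .{{NonZero e}} → Prime q → ¬ q ∣ e → μ (q * e) ≡ ℤ.- μ e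
μ-∤ {q} e q-prime q∤e with hasPrimeSquareDivisor? e
... | yes h@(x , x-prime , x²∣e) =
  trans (μ-primeSquareDivisor (q * e) (x , x-prime , ∣n⇒∣m*n q x²∣e))
        (sym (cong ℤ.-_ (μ-primeSquareDivisor e h)))
... | no sqfree with record { factors = qs ; isFactorisation = refl ; factorsPrime = primes } ← factorise e =
  trans (μ-distinctPrimes (q * e) (q-prime ∷ primes)
           (All.tabulate (λ x∈ → λ { refl → q∤e (∈⇒∣product x∈) }) ∷ qs!) refl)
    (trans (ℤ.-1*i≡-i _) (cong ℤ.-_ (sym (μ-distinctPrimes e primes qs! refl))))
  where
  qs! = squarefree⇒unique primes sqfree

prime-∤⇒coprime : ∀ {q e} → Prime q → ¬ q ∣ e → Coprime e q
prime-∤⇒coprime q-prime q∤e (d∣e , d∣q) with prime⇒irreducible q-prime d∣q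
... | inj₁ d≡1  = d≡1
... | inj₂ refl = contradiction d∣e q∤e

module _ {q N} (q-prime : Prime q) (1≤N : 1 ≤ N) {m} (qN≤m : q * N ≤ m) where
  private
    -- The divisors of `N` and of `q * N` are both selected from `range m`, which contains them all
    -- because `q * N ≤ m`. The bound `m` stays free so that one list can later serve every `N`.
    D : ℕ → List ℕ
    D n = filter (_∣? n) (range m)

    D! : ∀ n → Unique (D n)
    D! n = Unique.filter⁺ (_∣? n) (range! m)

    ∈-D⁻ : ∀ {n e} → e ∈ D n → 1 ≤ e × e ∣ n
    ∈-D⁻ {n} e∈ = let e∈range , e∣n = ∈-filter⁻ (_∣? n) {xs = range m} e∈
               in proj₁ (∈-range⁻ e∈range) , e∣n

    ∈-D⁺ : ∀ {n e} → 1 ≤ n → n ≤ m → 1 ≤ e → e ∣ n → e ∈ D n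
    ∈-D⁺ {n} 1≤n n≤m 1≤e e∣n =
      ∈-filter⁺ (_∣? n) (∈-range⁺ 1≤e (ℕ.≤-trans (∣⇒≤ {{>-nonZero 1≤n}} e∣n) n≤m)) e∣n

    instance
      q≢0 : NonZero q
      q≢0 = prime⇒nonZero q-prime

    1≤qN : 1 ≤ q * N
    1≤qN = ℕ.*-mono-≤ (>-nonZero⁻¹ q) 1≤N

    N≤m : N ≤ m
    N≤m = ℕ.≤-trans (ℕ.m≤n*m N q) qN≤m

    -- Writing such a divisor as `q * e`, cancellation of `q` turns `q * e ∣ q * N` into `e ∣ N`.
    D-∣ : filter (q ∣?_) (D (q * N)) ↭ map (_*_ q) (D N)
    D-∣ = unique∧set⇒↭ (Unique.filter⁺ (q ∣?_) (D! (q * N)))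
            (Unique.map⁺ (ℕ.*-cancelˡ-≡ _ _ q) (D! N)) to from
      where
      to : ∀ {d} → d ∈ filter (q ∣?_) (D (q * N)) → d ∈ map (_*_ q) (D N)
      to d∈ with d∈D , divides e refl ← ∈-filter⁻ (q ∣?_) {xs = D (q * N)} d∈
            with 1≤eq , eq∣qN ← ∈-D⁻ {q * N} d∈D =
        subst (_∈ map (_*_ q) (D N)) (ℕ.*-comm q e)
          (∈-map⁺ (_*_ q) (∈-D⁺ 1≤N N≤m (>-nonZero⁻¹ e {{ℕ.m*n≢0⇒m≢0 e {{>-nonZero 1≤eq}}}})
            (*-cancelˡ-∣ q (subst (_∣ q * N) (ℕ.*-comm e q) eq∣qN))))

      from : ∀ {d} → d ∈ map (_*_ q) (D N) → d ∈ filter (q ∣?_) (D (q * N))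
      from d∈ with e , e∈ , refl ← ∈-map⁻ (_*_ q) d∈ =
        let 1≤e , e∣N = ∈-D⁻ {N} e∈
        in ∈-filter⁺ (q ∣?_)
             (∈-D⁺ 1≤qN qN≤m (ℕ.*-mono-≤ (>-nonZero⁻¹ q) 1≤e) (*-monoʳ-∣ q e∣N)) (m∣m*n e)

    -- A divisor of `q * N` not divisible by the prime `q` is coprime to it, hence divides `N`.
    D-∤ : filter (¬? ∘ (q ∣?_)) (D (q * N)) ↭ filter (¬? ∘ (q ∣?_)) (D N)
    D-∤ = unique∧set⇒↭ (Unique.filter⁺ (¬? ∘ (q ∣?_)) (D! (q * N))) (Unique.filter⁺ (¬? ∘ (q ∣?_)) (D! N))
      (λ d∈ → let d∈D , q∤d = ∈-filter⁻ (¬? ∘ (q ∣?_)) {xs = D (q * N)} d∈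
                  1≤d , d∣qN = ∈-D⁻ {q * N} d∈D
              in ∈-filter⁺ (¬? ∘ (q ∣?_))
                   (∈-D⁺ 1≤N N≤m 1≤d (coprime-divisor (prime-∤⇒coprime q-prime q∤d) d∣qN)) q∤d)
      (λ d∈ → let d∈D , q∤d = ∈-filter⁻ (¬? ∘ (q ∣?_)) {xs = D N} d∈
                  1≤d , d∣N = ∈-D⁻ {N} d∈D
              in ∈-filter⁺ (¬? ∘ (q ∣?_)) (∈-D⁺ 1≤qN qN≤m 1≤d (∣n⇒∣m*n q d∣N)) q∤d)

  -- The divisors q e with q ∤ e cancel the divisors e, and μ vanishes on the divisors q e with q ∣ e.
  ∑μ-prime* : ∑ (filter (_∣? q * N) (range m)) μ ≡ 0ℤ
  ∑μ-prime* = begin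
    ∑ (D (q * N)) μ                                                        ≡⟨ ∑-split (q ∣?_) μ (D (q * N)) ⟩
    ∑ (filter (q ∣?_) (D (q * N))) μ ℤ.+ ∑ (filter (¬? ∘ (q ∣?_)) (D (q * N))) μ
      ≡⟨ cong₂ ℤ._+_ (trans (∑-↭ μ D-∣) (∑-map (_*_ q) (D N))) (∑-↭ μ D-∤) ⟩
    ∑ (D N) (μ ∘ (_*_ q)) ℤ.+ ∑ D∤ μ
      ≡⟨ cong (ℤ._+ ∑ D∤ μ) (∑-split (q ∣?_) (μ ∘ (_*_ q)) (D N)) ⟩
    ∑ (filter (q ∣?_) (D N)) (μ ∘ (_*_ q)) ℤ.+ ∑ D∤ (μ ∘ (_*_ q)) ℤ.+ ∑ D∤ μ
      ≡⟨ cong (ℤ._+ ∑ D∤ μ) (cong₂ ℤ._+_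
           (∑-zero (filter (q ∣?_) (D N)) λ e∈ → μ-∣ q-prime (proj₂ (∈-filter⁻ (q ∣?_) {xs = D N} e∈)))
           (trans (∑-cong D∤ negated) (∑-neg μ D∤))) ⟩
    0ℤ ℤ.+ ℤ.- ∑ D∤ μ ℤ.+ ∑ D∤ μ                                           ≡⟨ cancel (∑ D∤ μ) ⟩
    0ℤ                                                                     ∎
    where
    open ≡-Reasoning
    D∤ = filter (¬? ∘ (q ∣?_)) (D N)

    negated : ∀ {e} → e ∈ D∤ → μ (q * e) ≡ ℤ.- μ e
    negated {e} e∈ = let e∈D , q∤e = ∈-filter⁻ (¬? ∘ (q ∣?_)) {xs = D N} e∈
                     in μ-∤ e {{>-nonZero (proj₁ (∈-D⁻ {N} e∈D))}} q-prime q∤e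

    cancel : ∀ a → 0ℤ ℤ.+ ℤ.- a ℤ.+ a ≡ 0ℤ
    cancel = solve-∀

-- An empty factorisation means `N = 1`, whose only divisor is 1. Otherwise the first prime factor
-- `q` exhibits `N` as `q` times a positive number and `∑μ-prime*` applies.
∑μ : ∀ {N m} → 1 ≤ N → N ≤ m → ∑ (filter (_∣? N) (range m)) μ ≡ 𝟙 (N ≟ 1)
∑μ {N} {m} 1≤N N≤m with factorise N {{>-nonZero 1≤N}}
... | record { factors = [] ; isFactorisation = refl } = ∑-↭ μ divisors-1↭
  where
  divisors-1↭ : filter (_∣? 1) (range m) ↭ 1 ∷ []
  divisors-1↭ = unique∧set⇒↭ (Unique.filter⁺ (_∣? 1) (range! m)) ([] ∷ [])
    (λ d∈ → here (∣1⇒≡1 (proj₂ (∈-filter⁻ (_∣? 1) {xs = range m} d∈))))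
    (λ { (here refl) → ∈-filter⁺ (_∣? 1) (∈-range⁺ 1≤N N≤m) ∣-refl })
... | record { factors = q ∷ qs ; isFactorisation = refl ; factorsPrime = q-prime ∷ primes } =
  trans (∑μ-prime* q-prime (productOfPrimes≥1 primes) N≤m) (sym (𝟙-no (q * product qs ≟ 1) N≢1))
  where
  N≢1 : q * product qs ≢ 1
  N≢1 eq = ¬prime[1] (subst Prime (ℕ.m*n≡1⇒m≡1 q (product qs) eq) q-prime)

-- The double sum of P 4 (m ∸ N) μ k over k ∣ N, evaluated from either side

interval-∑ : ∀ l (f : ℕ → ℤ) → Σ[ 4 ⋯ 3 + l ] f ≡ ∑ (applyUpTo (_+_ 4) l) f
interval-∑ l f = cong (foldr ℤ._+_ 0ℤ)
  (trans (List.map-upTo (f ∘ _+_ 4) l) (sym (List.map-applyUpTo (_+_ 4) f l)))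

-- `range (3 + l)` unfolds to 1, 2, 3 followed by the indices from 4 on, and `μ` computes to 1, -1,
-- -1 on the first three. Moving these terms across in `∑μ` isolates the tail.
∑μ-≥4 : ∀ {l N} → 1 ≤ N → N ≤ 3 + l →
        ∑[ k ∈ applyUpTo (_+_ 4) l ] (𝟙 (k ∣? N) ℤ.* μ k)
        ≡ 𝟙 (N ≟ 1) ℤ.- 𝟙 (1 ∣? N) ℤ.+ 𝟙 (2 ∣? N) ℤ.+ 𝟙 (3 ∣? N)
∑μ-≥4 {l} {N} 1≤N N≤m =
  isolate (𝟙 (1 ∣? N)) (𝟙 (2 ∣? N)) (𝟙 (3 ∣? N)) _
    (trans (sym (∑μ {N} {3 + l} 1≤N N≤m)) (∑-filter (_∣? N) μ (range (3 + l))))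
  where
  regroup : ∀ a b c x → x ≡ (a ℤ.* 1ℤ ℤ.+ (b ℤ.* -1ℤ ℤ.+ (c ℤ.* -1ℤ ℤ.+ x))) ℤ.- a ℤ.+ b ℤ.+ c
  regroup = solve-∀

  isolate : ∀ a b c x {s} → s ≡ a ℤ.* 1ℤ ℤ.+ (b ℤ.* -1ℤ ℤ.+ (c ℤ.* -1ℤ ℤ.+ x)) → x ≡ s ℤ.- a ℤ.+ b ℤ.+ c
  isolate a b c x refl = regroup a b c x

-- With `m = 3 + l` the indices 4 to `m` are exactly `l` in number. Replacing `S` by `T` gives a
-- double sum over `k` and `N`; after exchanging the order, `∑μ-≥4` evaluates the sum over `k`.
∑Sμ : ∀ l → Σ[ 4 ⋯ 3 + l ] (λ k → + S 4 (3 + l) k ℤ.* μ k)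
            ≡ P 4 (2 + l) ℤ.- T 1 (P 4) (3 + l) ℤ.+ T 2 (P 4) (3 + l) ℤ.+ T 3 (P 4) (3 + l)
∑Sμ l = begin
  Σ[ 4 ⋯ m ] (λ k → + S 4 m k ℤ.* μ k)                             ≡⟨ interval-∑ l _ ⟩
  ∑[ k ∈ ks ] (+ S 4 m k ℤ.* μ k)                                  ≡⟨ ∑-cong ks expand ⟩
  ∑[ k ∈ ks ] (∑[ N ∈ range m ] (f N ℤ.* (𝟙 (k ∣? N) ℤ.* μ k)))    ≡⟨ ∑-swap _ ks (range m) ⟩
  ∑[ N ∈ range m ] (∑[ k ∈ ks ] (f N ℤ.* (𝟙 (k ∣? N) ℤ.* μ k)))    ≡⟨ ∑-cong (range m) collapse ⟩
  ∑[ N ∈ range m ] (one N ℤ.+ (ℤ.- mult 1 N ℤ.+ (mult 2 N ℤ.+ mult 3 N)))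
    ≡⟨ ∑-+ one (λ N → ℤ.- mult 1 N ℤ.+ (mult 2 N ℤ.+ mult 3 N)) (range m) ⟩
  ∑ (range m) one ℤ.+ ∑[ N ∈ range m ] (ℤ.- mult 1 N ℤ.+ (mult 2 N ℤ.+ mult 3 N))
    ≡⟨ cong (ℤ._+_ (∑ (range m) one)) (trans (∑-+ (ℤ.-_ ∘ mult 1) (λ N → mult 2 N ℤ.+ mult 3 N) (range m))
         (cong₂ ℤ._+_ (∑-neg (mult 1) (range m)) (∑-+ (mult 2) (mult 3) (range m)))) ⟩
  ∑ (range m) one ℤ.+ (ℤ.- ∑ (range m) (mult 1) ℤ.+ (∑ (range m) (mult 2) ℤ.+ ∑ (range m) (mult 3)))
    ≡⟨ cong₂ ℤ._+_ ∑-one (cong₂ ℤ._+_ (cong ℤ.-_ (T-mult 1)) (cong₂ ℤ._+_ (T-mult 2) (T-mult 3))) ⟩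
  P 4 (2 + l) ℤ.+ (ℤ.- T 1 (P 4) m ℤ.+ (T 2 (P 4) m ℤ.+ T 3 (P 4) m))
    ≡⟨ reassociate (P 4 (2 + l)) (T 1 (P 4) m) (T 2 (P 4) m) (T 3 (P 4) m) ⟩
  P 4 (2 + l) ℤ.- T 1 (P 4) m ℤ.+ T 2 (P 4) m ℤ.+ T 3 (P 4) m      ∎
  where
  open ≡-Reasoning
  m  = 3 + l
  ks = applyUpTo (_+_ 4) l

  f : ℕ → ℤ
  f N = P 4 (m ∸ N)

  one : ℕ → ℤ
  one N = 𝟙 (N ≟ 1) ℤ.* f N

  mult : ℕ → ℕ → ℤ
  mult k N = 𝟙 (k ∣? N) ℤ.* f N

  T-mult : ∀ k → ∑ (range m) (mult k) ≡ T k (P 4) m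
  T-mult k = sym (∑-filter (k ∣?_) f (range m))

  reassociate : ∀ a b c d → a ℤ.+ (ℤ.- b ℤ.+ (c ℤ.+ d)) ≡ a ℤ.- b ℤ.+ c ℤ.+ d
  reassociate = solve-∀

  -- Only `N = 1` survives, and `m ∸ 1` is `2 + l`.
  ∑-one : ∑ (range m) one ≡ P 4 (2 + l)
  ∑-one = trans (sym (∑-filter (_≟ 1) f (range m))) (trans (∑-↭ f (unique∧set⇒↭
      (Unique.filter⁺ (_≟ 1) (range! m)) ([] ∷ [])
      (λ N∈ → here (proj₂ (∈-filter⁻ (_≟ 1) {xs = range m} N∈)))
      (λ { (here refl) → here refl })))
    (ℤ.+-identityʳ (P 4 (2 + l))))

  expand : ∀ {k} → k ∈ ks → + S 4 m k ℤ.* μ k ≡ ∑[ N ∈ range m ] (f N ℤ.* (𝟙 (k ∣? N) ℤ.* μ k))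
  expand k∈ with i , _ , refl ← ∈-applyUpTo⁻ (_+_ 4) k∈ = begin
    + S 4 m k ℤ.* μ k                            ≡⟨ cong (ℤ._* μ k) (S≡T {4} (s≤s z≤n) (ℕ.m≤m+n 4 i) m) ⟩
    T k (P 4) m ℤ.* μ k                          ≡⟨ cong (ℤ._* μ k) (T-mult k) ⟨
    ∑ (range m) (mult k) ℤ.* μ k                 ≡⟨ ∑-*ʳ (μ k) (mult k) (range m) ⟨
    ∑[ N ∈ range m ] (mult k N ℤ.* μ k)          ≡⟨ ∑-cong (range m) (λ {N} _ → rotate (𝟙 (k ∣? N)) (f N) (μ k)) ⟩
    ∑[ N ∈ range m ] (f N ℤ.* (𝟙 (k ∣? N) ℤ.* μ k)) ∎
    where
    k = 4 + i

    rotate : ∀ a b c → a ℤ.* b ℤ.* c ≡ b ℤ.* (a ℤ.* c)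
    rotate = solve-∀

  collapse : ∀ {N} → N ∈ range m → ∑[ k ∈ ks ] (f N ℤ.* (𝟙 (k ∣? N) ℤ.* μ k))
             ≡ one N ℤ.+ (ℤ.- mult 1 N ℤ.+ (mult 2 N ℤ.+ mult 3 N))
  collapse {N} N∈ = let 1≤N , N≤m = ∈-range⁻ N∈ in begin
    ∑[ k ∈ ks ] (f N ℤ.* (𝟙 (k ∣? N) ℤ.* μ k))   ≡⟨ ∑-*ˡ (f N) _ ks ⟩
    f N ℤ.* ∑[ k ∈ ks ] (𝟙 (k ∣? N) ℤ.* μ k)     ≡⟨ cong (ℤ._*_ (f N)) (∑μ-≥4 1≤N N≤m) ⟩
    f N ℤ.* (𝟙 (N ≟ 1) ℤ.- 𝟙 (1 ∣? N) ℤ.+ 𝟙 (2 ∣? N) ℤ.+ 𝟙 (3 ∣? N))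
      ≡⟨ expandProduct (f N) (𝟙 (N ≟ 1)) (𝟙 (1 ∣? N)) (𝟙 (2 ∣? N)) (𝟙 (3 ∣? N)) ⟩
    one N ℤ.+ (ℤ.- mult 1 N ℤ.+ (mult 2 N ℤ.+ mult 3 N)) ∎
    where
    expandProduct : ∀ a b c d e → a ℤ.* (b ℤ.- c ℤ.+ d ℤ.+ e)
                    ≡ b ℤ.* a ℤ.+ (ℤ.- (c ℤ.* a) ℤ.+ (d ℤ.* a ℤ.+ e ℤ.* a))
    expandProduct = solve-∀

-- Reduction of P 2, P 3, P 4 and of their sums T to p

P₁≡p : ∀ m → P 1 m ≡ + p m
P₁≡p m = cong (+_ ∘ length) (List.filter-all (all? (1 ≤?_)) (All.tabulate (positive ∘ partitions-sound {m})))

P₂ : ∀ m → P 2 (1 + m) ≡ + p (1 + m) ℤ.- + p m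
P₂ m = trans (P-suc 1 m (s≤s z≤n)) (cong₂ ℤ._-_ (P₁≡p (1 + m)) (P₁≡p m))

P₃ : ∀ m → P 3 (2 + m) ≡ P 2 (2 + m) ℤ.- P 2 m
P₃ m = P-suc 2 m (s≤s z≤n)

P₄ : ∀ m → P 4 (3 + m) ≡ P 3 (3 + m) ℤ.- P 3 m
P₄ m = P-suc 3 m (s≤s z≤n)

P₃-p : ∀ m → P 3 (3 + m) ≡ + p (3 + m) ℤ.- + p (2 + m) ℤ.- (+ p (1 + m) ℤ.- + p m)
P₃-p m = trans (P₃ (1 + m)) (cong₂ ℤ._-_ (P₂ (2 + m)) (P₂ m))

-- In generating functions, `P 4` is (1-x)(1-x²)(1-x³) times that of `p`, and `T k` multiplies by
-- x^k/(1-x^k), cancelling one factor. Here x(1-x²)(1-x³) remains; the offset 6 keeps every index of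
-- `p` non-negative, and the base case is evaluated.
T₁ : ∀ m → T 1 (P 4) (6 + m) ≡ + p (5 + m) ℤ.- + p (3 + m) ℤ.- (+ p (2 + m) ℤ.- + p m)
T₁ zero    = refl
T₁ (suc m) = trans (T-rec {1} (P 4) (6 + m) (s≤s z≤n))
  (trans (cong₂ ℤ._+_ (trans (P₄ (3 + m)) (cong₂ ℤ._-_ (P₃-p (3 + m)) (P₃-p m))) (T₁ m))
    (telescope (+ p (6 + m)) (+ p (5 + m)) (+ p (4 + m)) (+ p (3 + m)) (+ p (2 + m)) (+ p (1 + m)) (+ p m)))
  where
  telescope : ∀ a₆ a₅ a₄ a₃ a₂ a₁ a₀ →
    a₆ ℤ.- a₅ ℤ.- (a₄ ℤ.- a₃) ℤ.- (a₃ ℤ.- a₂ ℤ.- (a₁ ℤ.- a₀)) ℤ.+ (a₅ ℤ.- a₃ ℤ.- (a₂ ℤ.- a₀))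
    ≡ a₆ ℤ.- a₄ ℤ.- (a₃ ℤ.- a₁)
  telescope = solve-∀

-- The factor 1-x² cancels, leaving x²(1-x³) times the series of `P 2`. Steps of 2 call for two
-- evaluated base cases.
T₂ : ∀ m → T 2 (P 4) (5 + m) ≡ P 2 (3 + m) ℤ.- P 2 m
T₂ zero          = refl
T₂ (suc zero)    = refl
T₂ (suc (suc m)) = trans (T-rec {2} (P 4) (5 + m) (s≤s z≤n))
  (trans (cong₂ ℤ._+_ (trans (P₄ (2 + m)) (cong₂ ℤ._-_ (P₃ (3 + m)) (P₃ m))) (T₂ m))
    (telescope (P 2 (5 + m)) (P 2 (3 + m)) (P 2 (2 + m)) (P 2 m)))
  where
  telescope : ∀ a₅ a₃ a₂ a₀ → a₅ ℤ.- a₃ ℤ.- (a₂ ℤ.- a₀) ℤ.+ (a₃ ℤ.- a₀) ≡ a₅ ℤ.- a₂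
  telescope = solve-∀

-- The factor 1-x³ cancels, leaving x³ times the series of `P 3`, with three base cases.
T₃ : ∀ m → T 3 (P 4) (3 + m) ≡ P 3 m
T₃ zero                = refl
T₃ (suc zero)          = refl
T₃ (suc (suc zero))    = refl
T₃ (suc (suc (suc m))) = trans (T-rec {3} (P 4) (3 + m) (s≤s z≤n))
  (trans (cong₂ ℤ._+_ (P₄ m) (T₃ m)) (telescope (P 3 (3 + m)) (P 3 m)))
  where
  telescope : ∀ a b → a ℤ.- b ℤ.+ b ≡ a
  telescope = solve-∀

-- The four terms of `∑Sμ` multiply the series of `p` by x(1-x)(1-x²)(1-x³) - x(1-x²)(1-x³) +
-- x²(1-x)(1-x³) + x³(1-x)(1-x²), which equals -x⁵(1-x)². This is the source of the shift by 5:
-- `8 + j` is 5 more than `3 + j`.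
∇²p-∑Sμ : ∀ j → + p (3 + j) ℤ.- + 2 ℤ.* + p (2 + j) ℤ.+ + p (1 + j)
                ≡ ℤ.- Σ[ 4 ⋯ 8 + j ] (λ k → + S 4 (8 + j) k ℤ.* μ k)
∇²p-∑Sμ j = sym (trans (cong ℤ.-_ (trans (∑Sμ (5 + j))
  (cong₂ ℤ._+_ (cong₂ ℤ._+_ (cong₂ ℤ._-_
    (trans (P₄ (4 + j)) (cong₂ ℤ._-_ (P₃-p (4 + j)) (P₃-p (1 + j)))) (T₁ (2 + j)))
    (trans (T₂ (3 + j)) (cong₂ ℤ._-_ (P₂ (5 + j)) (P₂ (2 + j)))))
    (trans (T₃ (5 + j)) (P₃-p (2 + j))))))
  (collect (+ p (7 + j)) (+ p (6 + j)) (+ p (5 + j)) (+ p (4 + j)) (+ p (3 + j)) (+ p (2 + j)) (+ p (1 + j))))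
  where
  collect : ∀ a₇ a₆ a₅ a₄ a₃ a₂ a₁ →
    ℤ.- (a₇ ℤ.- a₆ ℤ.- (a₅ ℤ.- a₄) ℤ.- (a₄ ℤ.- a₃ ℤ.- (a₂ ℤ.- a₁)) ℤ.- (a₇ ℤ.- a₅ ℤ.- (a₄ ℤ.- a₂))
         ℤ.+ (a₆ ℤ.- a₅ ℤ.- (a₃ ℤ.- a₂)) ℤ.+ (a₅ ℤ.- a₄ ℤ.- (a₃ ℤ.- a₂)))
    ≡ a₃ ℤ.- + 2 ℤ.* a₂ ℤ.+ a₁
  collect = solve-∀

-- The signs and binomial coefficients compute to 1, -2, 1, so a ring identity is all that is left.
∇²-expand : ∀ f n → ∇^ 2 f n ≡ f n ℤ.- + 2 ℤ.* f (n ∸ 1) ℤ.+ f (n ∸ 2)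
∇²-expand f n = expand (f n) (f (n ∸ 1)) (f (n ∸ 2))
  where
  expand : ∀ a b c → 1ℤ ℤ.* a ℤ.+ (ℤ.- + 2 ℤ.* b ℤ.+ (1ℤ ℤ.* c ℤ.+ 0ℤ)) ≡ a ℤ.- + 2 ℤ.* b ℤ.+ c
  expand = solve-∀

corollary1p6 : (n : ℕ) → 3 ≤ n →
    (+ #NoOnesLargestRepeated n ≡ ∇^ 2 (λ m → + p m) n)
    × (∇^ 2 (λ m → + p m) n ≡ (+ p n) ℤ.- (+ 2) ℤ.* (+ p (n ∸ 1)) ℤ.+ (+ p (n ∸ 2)))
    × (∇^ 2 (λ m → + p m) n ≡ ℤ.- (Σ[ 4 ⋯ n + 5 ] (λ k → (+ S 4 (n + 5) k) ℤ.* μ k)))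
corollary1p6 n@(suc (suc (suc j))) (s≤s 2≤n-1@(s≤s (s≤s _))) =
    -- By `P₂`, partitions without ones are counted by the first difference of `p`, so the
    -- difference of two consecutive counts is the second difference.
    trans (#NoOnesLargestRepeated-P₂ (2 + j) 2≤n-1)
      (trans (cong₂ ℤ._-_ (P₂ (2 + j)) (P₂ (1 + j)))
        (trans (collect (+ p n) (+ p (2 + j)) (+ p (1 + j))) (sym ∇²p)))
  , ∇²p
  -- `5 + n` reduces to the `8 + j` of `∇²p-∑Sμ`, and commutativity turns it into `n + 5`.
  , trans ∇²p (subst (λ m → + p n ℤ.- + 2 ℤ.* + p (n ∸ 1) ℤ.+ + p (n ∸ 2)
                           ≡ ℤ.- Σ[ 4 ⋯ m ] (λ k → + S 4 m k ℤ.* μ k))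
      (ℕ.+-comm 5 n) (∇²p-∑Sμ j))
  where
  ∇²p = ∇²-expand (λ m → + p m) n

  collect : ∀ a b c → a ℤ.- b ℤ.- (b ℤ.- c) ≡ a ℤ.- + 2 ℤ.* b ℤ.+ c
  collect = solve-∀
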